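{- For any $r\ge 3$, the competitive ratio of the Move-All-Equally algorithm for $r$-uniform Online Min-Sum Set Cover against the dynamic optimum is $\Omega(r\sqrt{n})$; that is, there is an absolute constant $c>0$ such that for every $r\ge 3$ there are arbitrarily large $n$ for which the competitive ratio of Move-All-Equally against the dynamic optimum is at least $c\,r\sqrt{n}$.
   Context: Let $U$ be a set of $n$ elements; a permutation $\pi$ of $U$ gives each element $e$ a position $\pi[e]\in\{1,\dots,n\}$, and $\pi(S)=\min_{e\in S}\pi[e]$. $d_{KT}(\pi,\sigma)$ is the number of pairs of elements ordered differently by $\pi,\sigma$. In $r$-uniform Online Min-Sum Set Cover, from an initial permutation $\pi_0$, request sets $S_1,\dots,S_m$ with $|S_t|=r$ arrive online; on arrival of $S_t$ an algorithm holding $\pi_{t-1}$ pays access cost $\pi_{t-1}(S_t)$ and then moves to $\pi_t$ paying $d_{KT}(\pi_{t-1},\pi_t)$. The dynamic optimum is $\mathrm{OPT}_{dyn}=\min\sum_{t=1}^m\big(\pi^*_t(S_t)+d_{KT}(\pi^*_{t-1},\pi^*_t)\big)$ over all sequences $\pi^*_1,\dots,\pi^*_m$ with $\pi^*_0=\pi_0$. An algorithm is $c$-competitive against the dynamic optimum if its cost is at most $c\cdot\mathrm{OPT}_{dyn}+\alpha$ for all initial permutations and sequences, with $\alpha$ independent of the sequence; the competitive ratio is the infimum of such $c$. Move-All-Equally: given current permutation $\pi$ and request $S$, let $k=\pi(S)$; the new permutation places each $e\in S$ at position $\pi[e]-(k-1)$ and the elements of $U\setminus S$ fill the remaining positions in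 their relative order in $\pi$. -}

module Defs where

open import Data.Nat using (ℕ; zero; suc; _+_; _∸_; _⊓_; _<_; _<ᵇ_)
open import Data.Bool using (Bool; true; false; if_then_else_; _∧_)
open import Data.Fin using (Fin; toℕ)
open import Data.Fin.Subset using (Subset; _∈_; _∉_)
open import Data.Fin.Subset.Properties using (_∈?_)
open import Data.Fin.Permutation using (Permutation′; _⟨$⟩ʳ_)
open import Data.List using (List; map; filter; foldr; allFin)
open import Data.Nat.ListAction using (sum)
open import Data.Vec using (Vec; []; _∷_)
open import Data.Product using (_×_)
open import Data.Unit using (⊤)
open import Relation.Binary.PropositionalEquality using (_≡_)

-- A permutation of U = Fin n; π ⟨$⟩ʳ e is the 0-based position of element e.
Perm : ℕ → Set
Perm n = Permutation′ n

pos : ∀ {n} → Perm n → Fin n → ℕ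
pos π e = suc (toℕ (π ⟨$⟩ʳ e))

-- π(S) = min_{e ∈ S} π[e]  (for nonempty S; the fold starts at n ≥ every position)
access : ∀ {n} → Perm n → Subset n → ℕ
access {n} π S = foldr _⊓_ n (map (pos π) (filter (λ e → e ∈? S) (allFin n)))

-- Kendall tau distance: number of (ordered) pairs (i , j) with π[i] < π[j]
-- and σ[j] < σ[i]; each discordant unordered pair is counted exactly once.
dKT : ∀ {n} → Perm n → Perm n → ℕ
dKT {n} π σ =
  sum (map (λ i → sum (map (λ j →
    if (pos π i <ᵇ pos π j) ∧ (pos σ j <ᵇ pos σ i) then 1 else 0)
    (allFin n))) (allFin n))

MAEStep : ∀ {n} → Perm n → Subset n → Perm n → Set
MAEStep π S σ =
  (∀ e → e ∈ S → pos σ e ≡ pos π e ∸ (access π S ∸ 1)) ×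
  (∀ e f → e ∉ S → f ∉ S → pos π e < pos π f → pos σ e < pos σ f)

MAERun : ∀ {n m} → Perm n → Vec (Subset n) m → Vec (Perm n) m → Set
MAERun π [] [] = ⊤
MAERun π (S ∷ Ss) (σ ∷ σs) = MAEStep π S σ × MAERun σ Ss σs

onlineCost : ∀ {n m} → Perm n → Vec (Subset n) m → Vec (Perm n) m → ℕ
onlineCost π [] [] = 0
onlineCost π (S ∷ Ss) (σ ∷ σs) = access π S + dKT π σ + onlineCost σ Ss σs

offlineCost : ∀ {n m} → Perm n → Vec (Subset n) m → Vec (Perm n) m → ℕ
offlineCost π [] [] = 0
offlineCost π (S ∷ Ss) (σ ∷ σs) = access σ S + dKT π σ + offlineCost σ Ss σs

{-# OPTIONS --safe #-}
-- Two groups X and Y of h ≈ √n elements each stand in the list of Move-All-Equally as contiguous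
-- blocks, X near the front and Y near the back, h² positions further on.  The elements of Y, the
-- foremost one first, are each requested h times in a row, every time together with r − 1 other
-- elements chosen so that the minimum position is h + 1.  Each request then moves all its
-- elements h positions forward at a cost of at least r h, and h requests bring an element of Y to
-- the place vacated by X.  Meanwhile each request pushes X back by exactly one position: one of the
-- companions, standing right behind X, jumps over the whole block (or the element of Y itself crosses
-- it).  After h² requests X and Y have exactly exchanged places, and the construction repeats with
-- their roles swapped.  Offline, X and Y are kept in the first 2 h positions and the current element
-- is moved to the very front, so h requests cost at most 2 h + h = 3 h, against h · r h online.
module Submission where

open import Defs

module Game where

  open import Algebra.Properties.CommutativeMonoid.Sum using ()
  open import Data.Bool using (Bool; true; false; if_then_else_; _∧_; T)
  open import Data.Bool.Properties using (T-∧)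
  open import Data.Fin using (Fin; toℕ; fromℕ<) renaming (zero to fzero; suc to fsuc)
  open import Data.Fin.Permutation using (_⟨$⟩ʳ_; _⟨$⟩ˡ_; inverseˡ; inverseʳ; permutation; _∘ₚ_) renaming (id to idₚ)
  open import Data.Fin.Properties using (toℕ-injective; toℕ<n; toℕ-fromℕ<)
  open import Data.Fin.Subset using (Subset; ∣_∣; _∈_; _∉_)
  open import Data.Fin.Subset.Properties using (_∈?_)
  open import Data.List as List using (List; []; _∷_; allFin; applyUpTo; length; map; upTo; _++_)
  open import Data.List.Membership.Propositional using (find) renaming (_∈_ to _∈ˡ_)
  open import Data.List.Membership.Propositional.Properties
    using (∈-allFin; ∈-filter⁺; ∈-filter⁻; ∈-map⁺; ∈-upTo⁺; ∈-++⁺ˡ; ∈-++⁺ʳ)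
  open import Data.List.Properties using (length-++; length-applyUpTo; length-map; length-upTo; map-cong; map-tabulate)
  open import Data.List.Relation.Unary.All as All using (All; []; _∷_)
  import Data.List.Relation.Unary.All.Properties as Allₚ
  open import Data.List.Relation.Unary.AllPairs using (AllPairs; []; _∷_)
  import Data.List.Relation.Unary.AllPairs.Properties as AllPairsₚ
  open import Data.List.Relation.Unary.Any as Any using (Any; here; there; any?)
  open import Data.Nat hiding (_/_)
  open import Data.Nat.DivMod using (_mod_; m<n⇒m%n≡m; m%n<n)
  open import Data.Nat.Induction using (<-wellFounded)
  open import Data.Nat.ListAction using () renaming (sum to sumˡ)
  open import Data.Nat.Properties
  open import Data.Nat.Tactic.RingSolver using (solve-∀)
  open import Data.Product using (Σ; _×_; _,_; proj₁; proj₂)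
  open import Data.Sum using (_⊎_; inj₁; inj₂)
  open import Data.Unit using (tt)
  open import Data.Vec as Vec using (Vec; []; _∷_)
  open import Data.Vec.Properties using (lookup∘tabulate; []=⇒lookup; lookup⇒[]=)
  import Data.Vec.Relation.Unary.All as Vecᴬ
  open import Function using (_∘_; id; Equivalence)
  open import Induction.WellFounded using (Acc; acc)
  open import Relation.Binary.Definitions using (tri<; tri≈; tri>)
  open import Relation.Binary.PropositionalEquality
  open import Relation.Nullary using (¬_; Dec; yes; no; does; contradiction)
  open import Relation.Nullary.Decidable using (dec-true; dec-false)

  open Algebra.Properties.CommutativeMonoid.Sum +-0-commutativeMonoid
    using (∑-distrib-+; ∑-comm; sum-permute) renaming (sum to ∑; sum-cong-≗ to ∑-cong)

  -- Positions and sums of indicators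

  ind : Bool → ℕ
  ind b = if b then 1 else 0

  at : ∀ {n} → Perm n → Fin n → ℕ
  at π e = toℕ (π ⟨$⟩ʳ e)

  at-injective : ∀ {n} (π : Perm n) {e f} → at π e ≡ at π f → e ≡ f
  at-injective π eq =
    trans (sym (inverseˡ π)) (trans (cong (π ⟨$⟩ˡ_) (toℕ-injective eq)) (inverseˡ π))

  at<n : ∀ {n} (π : Perm n) e → at π e < n
  at<n π e = toℕ<n (π ⟨$⟩ʳ e)

  ind-≤-+ : ∀ {a} b c → (T a → T b ⊎ T c) → ind a ≤ ind b + ind c
  ind-≤-+ {false} b     c     _ = z≤n
  ind-≤-+ {true}  true  c     _ = s≤s z≤n
  ind-≤-+ {true}  false true  _ = s≤s z≤n
  ind-≤-+ {true}  false false h with h tt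
  ... | inj₁ ()
  ... | inj₂ ()

  ∑-mono : ∀ {n} {f g : Fin n → ℕ} → (∀ i → f i ≤ g i) → ∑ f ≤ ∑ g
  ∑-mono {zero}  h = z≤n
  ∑-mono {suc n} h = +-mono-≤ (h fzero) (∑-mono (h ∘ fsuc))

  ∑-zero : ∀ {n} {f : Fin n → ℕ} → (∀ i → f i ≡ 0) → ∑ f ≡ 0
  ∑-zero {zero}  h = refl
  ∑-zero {suc n} h = cong₂ _+_ (h fzero) (∑-zero (h ∘ fsuc))

  sumˡ-tabulate : ∀ {n} (f : Fin n → ℕ) → sumˡ (List.tabulate f) ≡ ∑ f
  sumˡ-tabulate {zero}  f = refl
  sumˡ-tabulate {suc n} f = cong (f fzero +_) (sumˡ-tabulate (f ∘ fsuc))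

  sumˡ-allFin : ∀ {n} (f : Fin n → ℕ) → sumˡ (List.map f (allFin n)) ≡ ∑ f
  sumˡ-allFin f = trans (cong sumˡ (map-tabulate (λ i → i) f)) (sumˡ-tabulate f)

  ∑-below : ∀ {n c} → c ≤ n → ∑ {n} (λ i → ind (toℕ i <ᵇ c)) ≡ c
  ∑-below {n}     {zero}  _       = ∑-zero {n} (λ _ → refl)
  ∑-below {suc n} {suc c} (s≤s h) = cong suc (∑-below h)

  ∑-at-below : ∀ {n c} (π : Perm n) → c ≤ n → ∑ (λ e → ind (at π e <ᵇ c)) ≡ c
  ∑-at-below {c = c} π h = trans (sym (sum-permute (λ i → ind (toℕ i <ᵇ c)) π)) (∑-below h)

  -- Kendall tau distance as a double sum

  discordant : ∀ {n} → Perm n → Perm n → Fin n → Fin n → Bool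
  discordant π σ i j = (at π i <ᵇ at π j) ∧ (at σ j <ᵇ at σ i)

  Discordant : ∀ {n} → Perm n → Perm n → Fin n → Fin n → Set
  Discordant π σ i j = at π i < at π j × at σ j < at σ i

  discordant⁻ : ∀ {n} (π σ : Perm n) {i j} → T (discordant π σ i j) → Discordant π σ i j
  discordant⁻ π σ {i} {j} t with Equivalence.to (T-∧ {at π i <ᵇ at π j}) t
  ... | u , v = <ᵇ⇒< _ _ u , <ᵇ⇒< _ _ v

  discordant⁺ : ∀ {n} (π σ : Perm n) {i j} → Discordant π σ i j → T (discordant π σ i j)
  discordant⁺ π σ {i} {j} (u , v) = Equivalence.from (T-∧ {at π i <ᵇ at π j}) (<⇒<ᵇ u , <⇒<ᵇ v)

  dKT-∑ : ∀ {n} (π σ : Perm n) → dKT π σ ≡ ∑ λ i → ∑ λ j → ind (discordant π σ i j)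
  dKT-∑ {n} π σ =
    trans (sumˡ-allFin {n} _) (∑-cong λ i → sumˡ-allFin (λ j → ind (discordant π σ i j)))

  dKT-self : ∀ {n} (π : Perm n) → dKT π π ≡ 0
  dKT-self π = trans (dKT-∑ π π) (∑-zero λ i → ∑-zero λ j → zero-ind i j)
    where
    zero-ind : ∀ i j → ind (discordant π π i j) ≡ 0
    zero-ind i j with discordant π π i j in eq
    ... | false = refl
    ... | true  = let u , v = discordant⁻ π π {i} {j} (subst T (sym eq) tt) in contradiction v (<-asym u)

  -- If `π` and `τ` disagree on a pair, then `σ`, which also orders it strictly, disagrees with one
  -- of the two. This is applied pair by pair.
  dKT-triangle : ∀ {n} (π σ τ : Perm n) → dKT π τ ≤ dKT π σ + dKT σ τ
  dKT-triangle π σ τ = begin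
    dKT π τ                                        ≡⟨ dKT-∑ π τ ⟩
    ∑ (λ i → ∑ λ j → ind (discordant π τ i j))
      ≤⟨ ∑-mono (λ i → ∑-mono λ j → ind-≤-+ (discordant π σ i j) (discordant σ τ i j) (via i j)) ⟩
    ∑ (λ i → ∑ λ j → ind (discordant π σ i j) + ind (discordant σ τ i j))
      ≡⟨ ∑-cong (λ i → ∑-distrib-+ (λ j → ind (discordant π σ i j)) (λ j → ind (discordant σ τ i j))) ⟩
    ∑ (λ i → ∑ (λ j → ind (discordant π σ i j)) + ∑ (λ j → ind (discordant σ τ i j)))
      ≡⟨ ∑-distrib-+ (λ i → ∑ λ j → ind (discordant π σ i j)) (λ i → ∑ λ j → ind (discordant σ τ i j)) ⟩
    ∑ (λ i → ∑ λ j → ind (discordant π σ i j)) + ∑ (λ i → ∑ λ j → ind (discordant σ τ i j))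
      ≡⟨ cong₂ _+_ (dKT-∑ π σ) (dKT-∑ σ τ) ⟨
    dKT π σ + dKT σ τ                              ∎
    where
    open ≤-Reasoning
    via : ∀ i j → T (discordant π τ i j) → T (discordant π σ i j) ⊎ T (discordant σ τ i j)
    via i j t with discordant⁻ π τ {i} {j} t | <-cmp (at σ i) (at σ j)
    ... | u , v | tri< w _ _ = inj₂ (discordant⁺ σ τ {i} {j} (w , v))
    ... | u , v | tri> _ _ w = inj₁ (discordant⁺ π σ {i} {j} (u , w))
    ... | u , v | tri≈ _ w _ = contradiction u (<-irrefl (cong (at π) (at-injective σ w)))

  -- At least π[j] − σ[j] of the elements in front of j in π must be overtaken by j.
  forward-≤-discordant : ∀ {n} (π σ : Perm n) j → at π j ≤ at σ j + ∑ λ i → ind (discordant π σ i j)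
  forward-≤-discordant π σ j = begin
    at π j                                   ≡⟨ ∑-at-below π (<⇒≤ (at<n π j)) ⟨
    ∑ (λ i → ind (at π i <ᵇ at π j))
      ≤⟨ ∑-mono (λ i → ind-≤-+ (at σ i <ᵇ at σ j) (discordant π σ i j) (split i)) ⟩
    ∑ (λ i → ind (at σ i <ᵇ at σ j) + ind (discordant π σ i j))
      ≡⟨ ∑-distrib-+ (λ i → ind (at σ i <ᵇ at σ j)) (λ i → ind (discordant π σ i j)) ⟩
    ∑ (λ i → ind (at σ i <ᵇ at σ j)) + ∑ (λ i → ind (discordant π σ i j))
      ≡⟨ cong (_+ ∑ λ i → ind (discordant π σ i j)) (∑-at-below σ (<⇒≤ (at<n σ j))) ⟩
    at σ j + ∑ (λ i → ind (discordant π σ i j)) ∎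
    where
    open ≤-Reasoning
    split : ∀ i → T (at π i <ᵇ at π j) → T (at σ i <ᵇ at σ j) ⊎ T (discordant π σ i j)
    split i t with <ᵇ⇒< (at π i) (at π j) t | <-cmp (at σ i) (at σ j)
    ... | u | tri< w _ _ = inj₁ (<⇒<ᵇ w)
    ... | u | tri> _ _ w = inj₂ (discordant⁺ π σ {i} {j} (u , w))
    ... | u | tri≈ _ w _ = contradiction u (<-irrefl (cong (at π) (at-injective σ w)))

  ∑-ind-* : ∀ {n} (b : Fin n → Bool) h → ∑ (λ i → ind (b i) * h) ≡ ∑ (λ i → ind (b i)) * h
  ∑-ind-* {zero}  b h = refl
  ∑-ind-* {suc n} b h = trans (cong (ind (b fzero) * h +_) (∑-ind-* (b ∘ fsuc) h))
                              (sym (*-distribʳ-+ h (ind (b fzero)) _))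

  card-∑ : ∀ {n} (S : Subset n) → ∣ S ∣ ≡ ∑ λ e → ind (Vec.lookup S e)
  card-∑ []          = refl
  card-∑ (true  ∷ S) = cong suc (card-∑ S)
  card-∑ (false ∷ S) = card-∑ S

  -- A discordant pair is charged only to the element `j` that overtakes the other one, so the
  -- bounds for the single elements of `S` add up without double counting.
  forward-≤-dKT : ∀ {n} (π σ : Perm n) (S : Subset n) h →
                  (∀ e → e ∈ S → at σ e + h ≤ at π e) → ∣ S ∣ * h ≤ dKT π σ
  forward-≤-dKT π σ S h fwd = begin
    ∣ S ∣ * h                                   ≡⟨ cong (_* h) (card-∑ S) ⟩
    ∑ (λ j → ind (Vec.lookup S j)) * h          ≡⟨ ∑-ind-* (Vec.lookup S) h ⟨
    ∑ (λ j → ind (Vec.lookup S j) * h)          ≤⟨ ∑-mono each ⟩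
    ∑ (λ j → ∑ λ i → ind (discordant π σ i j))  ≡⟨ ∑-comm (λ i j → ind (discordant π σ i j)) ⟨
    ∑ (λ i → ∑ λ j → ind (discordant π σ i j))  ≡⟨ dKT-∑ π σ ⟨
    dKT π σ                                     ∎
    where
    open ≤-Reasoning
    each : ∀ j → ind (Vec.lookup S j) * h ≤ ∑ λ i → ind (discordant π σ i j)
    each j with Vec.lookup S j in eq
    ... | false = z≤n
    ... | true rewrite +-identityʳ h =
      +-cancelˡ-≤ (at σ j) _ _ (≤-trans (fwd j (lookup⇒[]= j S eq)) (forward-≤-discordant π σ j))

  -- Access cost and determinism of the Move-All-Equally step

  foldr-⊓-≤ : ∀ {A : Set} (f : A → ℕ) b {x xs} → x ∈ˡ xs → List.foldr _⊓_ b (List.map f xs) ≤ f x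
  foldr-⊓-≤ f b (here refl)          = m⊓n≤m _ _
  foldr-⊓-≤ f b (there {x = y} x∈xs) = ≤-trans (m⊓n≤n (f y) _) (foldr-⊓-≤ f b x∈xs)

  foldr-⊓-≥ : ∀ {A : Set} (f : A → ℕ) {b m} → m ≤ b → ∀ xs → (∀ {x} → x ∈ˡ xs → m ≤ f x) →
              m ≤ List.foldr _⊓_ b (List.map f xs)
  foldr-⊓-≥ f m≤b []       h = m≤b
  foldr-⊓-≥ f m≤b (x ∷ xs) h = ⊓-glb (h (here refl)) (foldr-⊓-≥ f m≤b xs (h ∘ there))

  access-≤ : ∀ {n} (π : Perm n) {S e} → e ∈ S → access π S ≤ pos π e
  access-≤ {n} π {S} {e} e∈S = foldr-⊓-≤ (pos π) n (∈-filter⁺ (_∈? S) (∈-allFin e) e∈S)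

  access-≥ : ∀ {n} (π : Perm n) {S m} → m ≤ n → (∀ {e} → e ∈ S → m ≤ pos π e) → m ≤ access π S
  access-≥ {n} π {S} m≤n h =
    foldr-⊓-≥ (pos π) m≤n _ (λ x∈ → h (proj₂ (∈-filter⁻ (_∈? S) {xs = allFin n} x∈)))

  -- If σ[e] < τ[e], the element that τ places at σ[e] is another such element, further ahead in σ.
  MAEStep-≮ : ∀ {n} {π σ τ : Perm n} {S} → MAEStep π S σ → MAEStep π S τ →
              ∀ e → Acc _<_ (at σ e) → ¬ at σ e < at τ e
  MAEStep-≮ {π = π} {σ} {τ} {S} (σ-in , σ-out) (τ-in , τ-out) e (acc rs) lt with e ∈? S
  ... | yes e∈S = <-irrefl (suc-injective (trans (σ-in e e∈S) (sym (τ-in e e∈S)))) lt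
  ... | no  e∉S with (τ ⟨$⟩ˡ (σ ⟨$⟩ʳ e)) in f-def
  ... | f = MAEStep-≮ {π = π} {σ} {τ} (σ-in , σ-out) (τ-in , τ-out) f (rs σf<σe) (subst (at σ f <_) (sym τf≡σe) σf<σe)
    where
    τf≡σe : at τ f ≡ at σ e
    τf≡σe = cong toℕ (trans (cong (τ ⟨$⟩ʳ_) (sym f-def)) (inverseʳ τ))
    f∉S : f ∉ S
    f∉S f∈S = <-irrefl (trans (sym τf≡σe) (cong (at τ) f≡e)) lt
      where
      f≡e : f ≡ e
      f≡e = at-injective σ (trans (suc-injective (trans (σ-in f f∈S) (sym (τ-in f f∈S)))) τf≡σe)
    πf<πe : at π f < at π e
    πf<πe with <-cmp (at π f) (at π e)
    ... | tri< w _ _ = w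
    ... | tri≈ _ w _ = contradiction lt (<-irrefl (trans (sym τf≡σe) (cong (at τ) (at-injective π w))))
    ... | tri> _ _ w = contradiction (s≤s⁻¹ (τ-out e f e∉S f∉S (s≤s w)))
                                     (<-asym (subst (_< at τ e) (sym τf≡σe) lt))
    σf<σe : at σ f < at σ e
    σf<σe = s≤s⁻¹ (σ-out f e f∉S e∉S (s≤s πf<πe))

  -- Since `MAEStep` is a relation, this is what carries a bound for one explicitly built run over
  -- to every run on the same requests.
  MAEStep-unique : ∀ {n} {π σ τ : Perm n} {S} → MAEStep π S σ → MAEStep π S τ → ∀ e → at σ e ≡ at τ e
  MAEStep-unique {π = π} {σ} {τ} s t e with <-cmp (at σ e) (at τ e)
  ... | tri< w _ _ = contradiction w (MAEStep-≮ {π = π} {σ} {τ} s t e (<-wellFounded _))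
  ... | tri≈ _ w _ = w
  ... | tri> _ _ w = contradiction w (MAEStep-≮ {π = π} {τ} {σ} t s e (<-wellFounded _))

  -- Rotations of a window of positions

  data View (b d q : ℕ) : Set where
    low  : q < b → View b d q
    mid  : b ≤ q → q < b + d → View b d q
    top  : q ≡ b + d → View b d q
    high : b + d < q → View b d q

  view : ∀ b d q → View b d q
  view b d q with <-cmp q (b + d) | q <? b
  ... | tri< _ _ _ | yes q<b = low q<b
  ... | tri< w _ _ | no q≮b  = mid (≮⇒≥ q≮b) w
  ... | tri≈ _ w _ | _       = top w
  ... | tri> _ _ w | _       = high w

  advance-by : ∀ {b d q} → View b d q → ℕ
  advance-by {q = q} (low _)   = q
  advance-by {q = q} (mid _ _) = suc q
  advance-by {b = b} (top _)   = b
  advance-by {q = q} (high _)  = q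

  -- The cyclic rotation of the window [b , b + d] that brings b + d to b.
  advance : ℕ → ℕ → ℕ → ℕ
  advance b d q = advance-by (view b d q)

  advance-low : ∀ {b d q} → q < b → advance b d q ≡ q
  advance-low {b} {d} {q} q<b with view b d q
  ... | low _    = refl
  ... | mid w _  = contradiction q<b (≤⇒≯ w)
  ... | top refl = contradiction q<b (≤⇒≯ (m≤m+n b d))
  ... | high _   = refl

  advance-mid : ∀ {b d q} → b ≤ q → q < b + d → advance b d q ≡ suc q
  advance-mid {b} {d} {q} b≤q q<b+d with view b d q
  ... | low w    = contradiction w (≤⇒≯ b≤q)
  ... | mid _ _  = refl
  ... | top refl = contradiction q<b+d (<-irrefl refl)
  ... | high w   = contradiction q<b+d (<-asym w)

  advance-top : ∀ b d → advance b d (b + d) ≡ b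
  advance-top b d with view b d (b + d)
  ... | low w   = contradiction w (≤⇒≯ (m≤m+n b d))
  ... | mid _ w = contradiction w (<-irrefl refl)
  ... | top _   = refl
  ... | high w  = contradiction w (<-irrefl refl)

  advance-high : ∀ {b d q} → b + d < q → advance b d q ≡ q
  advance-high {b} {d} {q} lt with view b d q
  ... | low _    = refl
  ... | mid _ w  = contradiction w (<-asym lt)
  ... | top refl = contradiction lt (<-irrefl refl)
  ... | high _   = refl

  advance-≤-suc : ∀ b d q → advance b d q ≤ suc q
  advance-≤-suc b d q with view b d q
  ... | low _    = n≤1+n q
  ... | mid _ _  = ≤-refl
  ... | top refl = m≤n⇒m≤1+n (m≤m+n b d)
  ... | high _   = n≤1+n q

  advance-< : ∀ {b d n} q → b + d < n → q < n → advance b d q < n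
  advance-< {b} {d} q b+d<n q<n with view b d q
  ... | low _   = q<n
  ... | mid _ w = ≤-<-trans w b+d<n
  ... | top _   = ≤-<-trans (m≤m+n b d) b+d<n
  ... | high _  = q<n

  -- A rotation changes the order only relative to the element at its top. This is the source of the
  -- order clause of `MAEStep`.
  advance-mono : ∀ {b d q q′} → q < q′ → q ≢ b + d → q′ ≢ b + d → advance b d q < advance b d q′
  advance-mono {b} {d} {q} {q′} lt ≢q ≢q′ with view b d q | view b d q′
  ... | top w   | _        = contradiction w ≢q
  ... | _       | top w    = contradiction w ≢q′
  ... | low _   | low _    = lt
  ... | low _   | mid _ _  = m<n⇒m<1+n lt
  ... | low _   | high _   = lt
  ... | mid w _ | low w′   = contradiction (<-trans lt w′) (≤⇒≯ w)
  ... | mid _ _ | mid _ _  = s≤s lt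
  ... | mid _ w | high w′  = ≤-<-trans w w′
  ... | high w  | low w′   = contradiction (<-trans (≤-<-trans (m≤m+n b d) w) lt) (<-asym w′)
  ... | high w  | mid _ w′ = contradiction (<-trans w lt) (<-asym w′)
  ... | high _  | high _   = lt

  advance-inversion : ∀ {d q q′} → q < q′ → advance 0 d q′ < advance 0 d q → q < d × q′ ≡ d
  advance-inversion {d} {q} {q′} q<q′ inv = by-cases (q′ ≟ d) (q ≟ d)
    where
    by-cases : Dec (q′ ≡ d) → Dec (q ≡ d) → q < d × q′ ≡ d
    by-cases (yes w) _       = subst (q <_) w q<q′ , w
    by-cases (no _)  (yes w) =
      contradiction (subst (advance 0 d q′ <_) (trans (cong (advance 0 d) w) (advance-top 0 d)) inv) n≮0
    by-cases (no ¬w) (no ¬w′) = contradiction (advance-mono {0} {d} q<q′ ¬w′ ¬w) (<-asym inv)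

  -- The inverse of `advance`, written out so that the rotation can be packaged as a permutation.
  retreat : ℕ → ℕ → ℕ → ℕ
  retreat b d q with <-cmp q b | q ≤? b + d
  ... | tri< _ _ _ | _     = q
  ... | tri≈ _ _ _ | _     = b + d
  ... | tri> _ _ _ | yes _ = pred q
  ... | tri> _ _ _ | no _  = q

  retreat-advance : ∀ b d q → retreat b d (advance b d q) ≡ q
  retreat-advance b d q with view b d q
  ... | low w with <-cmp q b
  ...   | tri< _ _ _    = refl
  ...   | tri≈ ¬w _ _   = contradiction w ¬w
  ...   | tri> ¬w _ _   = contradiction w ¬w
  retreat-advance b d q | mid w w′ with <-cmp (suc q) b | suc q ≤? b + d
  ...   | tri< v _ _ | _     = contradiction w (<⇒≱ (<-trans (n<1+n q) v))
  ...   | tri≈ _ v _ | _     = contradiction w (<⇒≱ (≤-reflexive v))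
  ...   | tri> _ _ _ | yes _ = refl
  ...   | tri> _ _ _ | no v  = contradiction w′ v
  retreat-advance b d q | top refl with <-cmp b b
  ...   | tri< v _ _ = contradiction v (<-irrefl refl)
  ...   | tri≈ _ _ _ = refl
  ...   | tri> _ _ v = contradiction v (<-irrefl refl)
  retreat-advance b d q | high w with <-cmp q b | q ≤? b + d
  ...   | tri< _ _ _ | _      = refl
  ...   | tri≈ _ v _ | _      = contradiction (≤-trans w (≤-reflexive v)) (≤⇒≯ (m≤m+n b d))
  ...   | tri> _ _ _ | yes v  = contradiction w (≤⇒≯ v)
  ...   | tri> _ _ _ | no _   = refl

  advance-retreat : ∀ b d q → advance b d (retreat b d q) ≡ q
  advance-retreat b d q with <-cmp q b | q ≤? b + d
  ... | tri< w _ _    | _     = advance-low w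
  ... | tri≈ _ refl _ | _     = advance-top b d
  advance-retreat b d (suc q) | tri> _ _ (s≤s w) | yes v = advance-mid w v
  advance-retreat b d q | tri> _ _ _ | no v  = advance-high (≰⇒> v)

  retreat-< : ∀ {b d n} q → b + d < n → q < n → retreat b d q < n
  retreat-< {b} {d} q b+d<n q<n with <-cmp q b | q ≤? b + d
  ... | tri< _ _ _ | _     = q<n
  ... | tri≈ _ _ _ | _     = b+d<n
  ... | tri> _ _ _ | yes _ = ≤-<-trans pred[n]≤n q<n
  ... | tri> _ _ _ | no _  = q<n

  advanceₚ : ∀ {n} b d → b + d < n → Perm n
  advanceₚ {n} b d b+d<n = permutation to from
    (λ i → toℕ-injective (trans (toℕ-to (from i))
      (trans (cong (advance b d) (toℕ-from i)) (advance-retreat b d (toℕ i)))))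
    (λ i → toℕ-injective (trans (toℕ-from (to i))
      (trans (cong (retreat b d) (toℕ-to i)) (retreat-advance b d (toℕ i)))))
    where
    to from : Fin n → Fin n
    to i = fromℕ< (advance-< (toℕ i) b+d<n (toℕ<n i))
    from i = fromℕ< (retreat-< (toℕ i) b+d<n (toℕ<n i))
    toℕ-to : ∀ i → toℕ (to i) ≡ advance b d (toℕ i)
    toℕ-to i = toℕ-fromℕ< _
    toℕ-from : ∀ i → toℕ (from i) ≡ retreat b d (toℕ i)
    toℕ-from i = toℕ-fromℕ< _

  at-advanceₚ : ∀ {n} (π : Perm n) b d (b+d<n : b + d < n) e →
                at (π ∘ₚ advanceₚ b d b+d<n) e ≡ advance b d (at π e)
  at-advanceₚ π b d b+d<n e = toℕ-fromℕ< _

  ∑-point : ∀ {n c} → c < n → ∑ {n} (λ i → ind (toℕ i ≡ᵇ c)) ≡ 1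
  ∑-point {suc n} {zero}  _       = cong suc (∑-zero {n} (λ _ → refl))
  ∑-point {suc n} {suc c} (s≤s h) = ∑-point h

  -- By `advance-inversion`, the second element of a discordant pair is the one moved from `d` and
  -- the first stood before it. So each of the `d` elements ahead contributes at most one pair.
  dKT-advance-front : ∀ {n} (π : Perm n) d (d<n : d < n) → dKT π (π ∘ₚ advanceₚ 0 d d<n) ≤ d
  dKT-advance-front {n} π d d<n = begin
    dKT π σ                                    ≡⟨ dKT-∑ π σ ⟩
    ∑ (λ i → ∑ λ j → ind (discordant π σ i j)) ≤⟨ ∑-mono row ⟩
    ∑ (λ i → ind (at π i <ᵇ d))                ≡⟨ ∑-at-below π (<⇒≤ d<n) ⟩
    d                                          ∎
    where
    open ≤-Reasoning
    σ = π ∘ₚ advanceₚ 0 d d<n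
    overtaken : ∀ i j → T (discordant π σ i j) → at π i < d × at π j ≡ d
    overtaken i j t = let u , v = discordant⁻ π σ {i} {j} t in
      advance-inversion u (subst₂ _<_ (at-advanceₚ π 0 d d<n j) (at-advanceₚ π 0 d d<n i) v)
    row : ∀ i → ∑ (λ j → ind (discordant π σ i j)) ≤ ind (at π i <ᵇ d)
    row i = by-cases (at π i <ᵇ d) refl
      where
      single : ∀ j → ind (discordant π σ i j) ≤ ind (at π j ≡ᵇ d) + 0
      single j = ind-≤-+ (at π j ≡ᵇ d) false λ t → inj₁ (≡⇒≡ᵇ _ _ (proj₂ (overtaken i j t)))
      by-cases : ∀ b → (at π i <ᵇ d) ≡ b → ∑ (λ j → ind (discordant π σ i j)) ≤ ind b
      by-cases true _ = begin
        ∑ (λ j → ind (discordant π σ i j)) ≤⟨ ∑-mono (λ j → ≤-trans (single j) (≤-reflexive (+-identityʳ _))) ⟩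
        ∑ (λ j → ind (at π j ≡ᵇ d))        ≡⟨ sum-permute (λ p → ind (toℕ p ≡ᵇ d)) π ⟨
        ∑ {n} (λ p → ind (toℕ p ≡ᵇ d))     ≡⟨ ∑-point d<n ⟩
        1                                  ∎
      by-cases false eq = ≤-reflexive (∑-zero λ j → n≤0⇒n≡0 (ind-≤-+ false false λ t →
        contradiction (<⇒<ᵇ (proj₁ (overtaken i j t))) (subst T eq)))

  -- Composed rotations and the requests they serve

  advances : ℕ → List ℕ → ℕ → ℕ
  advances d []       q = q
  advances d (b ∷ bs) q = advances d bs (advance b d q)

  advances-low : ∀ {d q} bs → All (q <_) bs → advances d bs q ≡ q
  advances-low []       []       = refl
  advances-low {d} (b ∷ bs) (w ∷ ws) = trans (cong (advances d bs) (advance-low w)) (advances-low bs ws)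

  advances-high : ∀ {d q} bs → All (λ b → b + d < q) bs → advances d bs q ≡ q
  advances-high []       []       = refl
  advances-high {d} (b ∷ bs) (w ∷ ws) = trans (cong (advances d bs) (advance-high w)) (advances-high bs ws)

  -- For increasing targets, the windows treated earlier end before `b + d`, and those treated later
  -- begin after `b`; only the window of `b` itself moves this element.
  advances-top : ∀ {d b} bs → AllPairs _<_ bs → b ∈ˡ bs → advances d bs (b + d) ≡ b
  advances-top {d} (b ∷ bs) (ws ∷ _) (here refl) = trans (cong (advances d bs) (advance-top b d)) (advances-low bs ws)
  advances-top {d} (_ ∷ bs) (ws ∷ p) (there b∈) =
    trans (cong (advances d bs) (advance-high (+-monoˡ-< d (All.lookup ws b∈)))) (advances-top bs p b∈)

  advances-mono : ∀ {d q q′} bs → AllPairs _<_ bs → All (λ b → q ≢ b + d) bs → All (λ b → q′ ≢ b + d) bs →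
                  q < q′ → advances d bs q < advances d bs q′
  advances-mono [] [] [] [] lt = lt
  advances-mono {d} (b ∷ bs) (ws ∷ p) (v ∷ vs) (v′ ∷ vs′) lt =
    advances-mono bs p (avoid v vs) (avoid v′ vs′) (advance-mono lt v v′)
    where
    -- An element pushed back inside the window of `b` gets no further than `b + d`, which lies
    -- before every later `c + d`.
    avoid : ∀ {q} → q ≢ b + d → All (λ c → q ≢ c + d) bs → All (λ c → advance b d q ≢ c + d) bs
    avoid {q} v vs with view b d q
    ... | low _   = vs
    ... | mid _ w = All.map (λ b<c eq → <⇒≢ (≤-<-trans w (+-monoˡ-< d b<c)) eq) ws
    ... | top w   = contradiction w v
    ... | high _  = vs

  advancesₚ : ∀ {n} d bs → All (λ b → b + d < n) bs → Perm n → Perm n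
  advancesₚ d []       []       π = π
  advancesₚ d (b ∷ bs) (w ∷ ws) π = advancesₚ d bs ws (π ∘ₚ advanceₚ b d w)

  at-advancesₚ : ∀ {n} d bs (ws : All (λ b → b + d < n) bs) (π : Perm n) e →
                 at (advancesₚ d bs ws π) e ≡ advances d bs (at π e)
  at-advancesₚ d []       []       π e = refl
  at-advancesₚ d (b ∷ bs) (w ∷ ws) π e =
    trans (at-advancesₚ d bs ws _ e) (cong (advances d bs) (at-advanceₚ π b d w e))

  -- A request is given by the positions b its elements move to; they now stand at b + d.
  request : ∀ {n} → Perm n → ℕ → List ℕ → Subset n
  request π d bs = Vec.tabulate (λ e → does (any? (λ b → at π e ≟ b + d) bs))

  ∈-request⁺ : ∀ {n} (π : Perm n) {d b} bs {e} → b ∈ˡ bs → at π e ≡ b + d → e ∈ request π d bs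
  ∈-request⁺ π {d} bs {e} b∈ eq =
    lookup⇒[]= e (request π d bs) (trans (lookup∘tabulate _ e)
      (dec-true (any? (λ b → at π e ≟ b + d) bs) (Any.map (λ { refl → eq }) b∈)))

  ∈-request⁻ : ∀ {n} (π : Perm n) {d} bs {e} → e ∈ request π d bs → Any (λ b → at π e ≡ b + d) bs
  ∈-request⁻ π {d} bs {e} e∈ with any? (λ b → at π e ≟ b + d) bs in eq
  ... | yes w = w
  ... | no  w = contradiction (trans (sym ([]=⇒lookup e∈)) (trans (lookup∘tabulate _ e) (cong does eq))) λ ()

  ∉-request⁻ : ∀ {n} (π : Perm n) {d} bs {e} → e ∉ request π d bs → All (λ b → at π e ≢ b + d) bs
  ∉-request⁻ π bs e∉ = All.tabulate λ b∈ eq → e∉ (∈-request⁺ π bs b∈ eq)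

  ∑-members : ∀ {n} d bs → AllPairs _<_ bs → All (λ b → b + d < n) bs →
              ∑ {n} (λ i → ind (does (any? (λ b → toℕ i ≟ b + d) bs))) ≡ length bs
  ∑-members {n} d []       []       []       = ∑-zero {n} (λ _ → refl)
  ∑-members {n} d (b ∷ bs) (v ∷ vs) (w ∷ ws) = begin
    ∑ {n} (λ i → ind (does (any? (λ c → toℕ i ≟ c + d) (b ∷ bs))))
      ≡⟨ ∑-cong {n} split ⟩
    ∑ {n} (λ i → ind (toℕ i ≡ᵇ b + d) + ind (does (any? (λ c → toℕ i ≟ c + d) bs)))
      ≡⟨ ∑-distrib-+ {n} (λ i → ind (toℕ i ≡ᵇ b + d)) (λ i → ind (does (any? (λ c → toℕ i ≟ c + d) bs))) ⟩
    ∑ {n} (λ i → ind (toℕ i ≡ᵇ b + d)) + ∑ {n} (λ i → ind (does (any? (λ c → toℕ i ≟ c + d) bs)))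
      ≡⟨ cong₂ _+_ (∑-point w) (∑-members d bs vs ws) ⟩
    suc (length bs) ∎
    where
    open ≡-Reasoning
    split : ∀ (i : Fin n) → ind (does (any? (λ c → toℕ i ≟ c + d) (b ∷ bs)))
                ≡ ind (toℕ i ≡ᵇ b + d) + ind (does (any? (λ c → toℕ i ≟ c + d) bs))
    split i with toℕ i ≟ b + d
    ... | no ¬eq rewrite dec-false (toℕ i ≟ b + d) ¬eq = refl
    ... | yes eq rewrite dec-true (toℕ i ≟ b + d) eq
      | dec-false (any? (λ c → toℕ i ≟ c + d) bs)
                  (λ c → let c , c∈ , eq′ = find c in
                    <⇒≢ (+-monoˡ-< d (All.lookup v c∈)) (trans (sym eq) eq′)) = refl

  card-request : ∀ {n} (π : Perm n) {d} bs → AllPairs _<_ bs → All (λ b → b + d < n) bs →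
                 ∣ request π d bs ∣ ≡ length bs
  card-request {n} π {d} bs sorted ws = begin
    ∣ request π d bs ∣                             ≡⟨ card-∑ (request π d bs) ⟩
    ∑ (λ e → ind (Vec.lookup (request π d bs) e))
      ≡⟨ ∑-cong {n} (λ e → cong ind (lookup∘tabulate (member ∘ (π ⟨$⟩ʳ_)) e)) ⟩
    ∑ (λ e → ind (member (π ⟨$⟩ʳ e)))              ≡⟨ sum-permute (λ p → ind (member p)) π ⟨
    ∑ (λ p → ind (member p))                       ≡⟨ ∑-members d bs sorted ws ⟩
    length bs                                      ∎
    where
    open ≡-Reasoning
    member : Fin n → Bool
    member p = does (any? (λ b → toℕ p ≟ b + d) bs)

  -- The target `0` puts a requested element at 0-based position `d`, and no `b + d` is smaller;
  -- `pos` counts from 1.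
  access-request : ∀ {n} (π : Perm n) {d} bs → All (λ b → b + d < n) (0 ∷ bs) →
                   access π (request π d (0 ∷ bs)) ≡ suc d
  access-request {n} π {d} bs (d<n ∷ _) = ≤-antisym
    (≤-trans (access-≤ π (∈-request⁺ π (0 ∷ bs) {e} (here refl) at-e)) (≤-reflexive (cong suc at-e)))
    (access-≥ π d<n λ e∈ → let b , _ , eq = find (∈-request⁻ π (0 ∷ bs) e∈) in
      s≤s (≤-trans (m≤n+m d b) (≤-reflexive (sym eq))))
    where
    e = π ⟨$⟩ˡ fromℕ< d<n
    at-e : at π e ≡ d
    at-e = trans (cong toℕ (inverseʳ π)) (toℕ-fromℕ< d<n)

  -- The access cost is `suc d`, so each requested element has to move exactly `d` forward, as
  -- `advances-top` provides; `advances-mono` preserves the order of the others.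
  advancesₚ-MAEStep : ∀ {n} (π : Perm n) {d} bs → AllPairs _<_ (0 ∷ bs) → (ws : All (λ b → b + d < n) (0 ∷ bs)) →
                      MAEStep π (request π d (0 ∷ bs)) (advancesₚ d (0 ∷ bs) ws π)
  advancesₚ-MAEStep π {d} bs sorted ws rewrite access-request π bs ws = inside , outside
    where
    σ = advancesₚ d (0 ∷ bs) ws π
    inside : ∀ e → e ∈ request π d (0 ∷ bs) → pos σ e ≡ pos π e ∸ d
    inside e e∈ with find (∈-request⁻ π (0 ∷ bs) e∈)
    ... | b , b∈ , eq = begin
      suc (at σ e)                         ≡⟨ cong suc (at-advancesₚ d (0 ∷ bs) ws π e) ⟩
      suc (advances d (0 ∷ bs) (at π e))   ≡⟨ cong (suc ∘ advances d (0 ∷ bs)) eq ⟩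
      suc (advances d (0 ∷ bs) (b + d))    ≡⟨ cong suc (advances-top (0 ∷ bs) sorted b∈) ⟩
      suc b                                ≡⟨ m+n∸n≡m (suc b) d ⟨
      suc b + d ∸ d                        ≡⟨ cong (λ p → suc p ∸ d) eq ⟨
      suc (at π e) ∸ d                     ∎
      where open ≡-Reasoning
    outside : ∀ e f → e ∉ request π d (0 ∷ bs) → f ∉ request π d (0 ∷ bs) → pos π e < pos π f → pos σ e < pos σ f
    outside e f e∉ f∉ (s≤s lt) =
      s≤s (subst₂ _<_ (sym (at-advancesₚ d (0 ∷ bs) ws π e)) (sym (at-advancesₚ d (0 ∷ bs) ws π f))
        (advances-mono (0 ∷ bs) sorted (∉-request⁻ π (0 ∷ bs) e∉) (∉-request⁻ π (0 ∷ bs) f∉) lt))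

  -- Costs and runs depend only on the positions

  module _ {n} {π π′ : Perm n} (π≈π′ : ∀ e → at π e ≡ at π′ e) where

    access-cong : ∀ S → access π S ≡ access π′ S
    access-cong S = cong (List.foldr _⊓_ n)
      (map-cong (λ e → cong suc (π≈π′ e)) (List.filter (_∈? S) (allFin n)))

    dKT-congˡ : ∀ σ → dKT π σ ≡ dKT π′ σ
    dKT-congˡ σ = begin
      dKT π σ   ≡⟨ dKT-∑ π σ ⟩
      _         ≡⟨ ∑-cong (λ i → ∑-cong (λ j → cong₂ (λ a b → ind ((a <ᵇ b) ∧ (at σ j <ᵇ at σ i))) (π≈π′ i) (π≈π′ j))) ⟩
      _         ≡⟨ dKT-∑ π′ σ ⟨
      dKT π′ σ  ∎
      where open ≡-Reasoning

    MAEStep-congˡ : ∀ {S σ} → MAEStep π S σ → MAEStep π′ S σ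
    MAEStep-congˡ {S} {σ} (i , o) =
      (λ e e∈ → trans (i e e∈) (cong₂ (λ p a → suc p ∸ (a ∸ 1)) (π≈π′ e) (access-cong S))) ,
      (λ e f e∉ f∉ lt → o e f e∉ f∉ (subst₂ (λ a b → suc a < suc b) (sym (π≈π′ e)) (sym (π≈π′ f)) lt))

    MAERun-congˡ : ∀ {m} (Ss : Vec _ m) σs → MAERun π Ss σs → MAERun π′ Ss σs
    MAERun-congˡ []       []       _          = tt
    MAERun-congˡ (S ∷ Ss) (σ ∷ σs) (st , rn) = MAEStep-congˡ {S} {σ} st , rn

    onlineCost-congˡ : ∀ {m} (Ss : Vec _ m) σs → onlineCost π Ss σs ≡ onlineCost π′ Ss σs
    onlineCost-congˡ []       []       = refl
    onlineCost-congˡ (S ∷ Ss) (σ ∷ σs) =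
      cong₂ (λ a k → a + k + onlineCost σ Ss σs) (access-cong S) (dKT-congˡ σ)

  -- Plays: request sequences with bounds on both costs

  -- A request sequence against which Move-All-Equally pays at least A from π, while B suffices from Ω.
  record Play {n} (r : ℕ) (π Ω : Perm n) (A B : ℕ) : Set where
    field
      len      : ℕ
      requests : Vec (Subset n) len
      uniform  : Vecᴬ.All (λ S → ∣ S ∣ ≡ r) requests
      opt      : Vec (Perm n) len
      run      : Vec (Perm n) len
      isRun    : MAERun π requests run
      online≥  : ∀ run′ → MAERun π requests run′ → A ≤ onlineCost π requests run′
      offline≤ : offlineCost Ω requests opt ≤ B

  module _ {n r : ℕ} where
    open Play

    stop : ∀ {π Ω : Perm n} → Play r π Ω 0 0
    stop = record
      { len = 0 ; requests = [] ; uniform = Vecᴬ.[] ; opt = [] ; run = [] ; isRun = tt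
      ; online≥ = λ _ _ → z≤n ; offline≤ = z≤n }

    relax : ∀ {π Ω : Perm n} {A A′ B B′} → A′ ≤ A → B ≤ B′ → Play r π Ω A B → Play r π Ω A′ B′
    relax A′≤A B≤B′ P = record
      { Play P
      ; online≥  = λ run′ isRun′ → ≤-trans A′≤A (online≥ P run′ isRun′)
      ; offline≤ = ≤-trans (offline≤ P) B≤B′ }

    -- Only the first transition depends on the starting permutation, and the triangle inequality
    -- routes it through `Ω′`.
    offlineCost-from : ∀ (Ω Ω′ : Perm n) {m} (Ss : Vec _ m) σs →
                       offlineCost Ω Ss σs ≤ dKT Ω Ω′ + offlineCost Ω′ Ss σs
    offlineCost-from Ω Ω′ []       []       = z≤n
    offlineCost-from Ω Ω′ (S ∷ Ss) (σ ∷ σs) = begin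
      access σ S + dKT Ω σ + rest
      ≤⟨ +-monoˡ-≤ rest (+-monoʳ-≤ (access σ S) (dKT-triangle Ω Ω′ σ)) ⟩
      access σ S + (dKT Ω Ω′ + dKT Ω′ σ) + rest     ≡⟨ cong (_+ rest) (x+[y+z] (access σ S) (dKT Ω Ω′) (dKT Ω′ σ)) ⟩
      dKT Ω Ω′ + (access σ S + dKT Ω′ σ) + rest     ≡⟨ +-assoc (dKT Ω Ω′) _ rest ⟩
      dKT Ω Ω′ + (access σ S + dKT Ω′ σ + rest)     ∎
      where
      open ≤-Reasoning
      rest = offlineCost σ Ss σs
      x+[y+z] : ∀ x y z → x + (y + z) ≡ y + (x + z)
      x+[y+z] x y z = trans (sym (+-assoc x y z)) (trans (cong (_+ z) (+-comm x y)) (+-assoc y x z))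

    reorganise : ∀ {π : Perm n} Ω Ω′ {A B} → Play r π Ω′ A B → Play r π Ω A (dKT Ω Ω′ + B)
    reorganise Ω Ω′ P = record
      { Play P
      ; offline≤ = ≤-trans (offlineCost-from Ω Ω′ (requests P) (opt P)) (+-monoʳ-≤ _ (offline≤ P)) }

    -- Online, each of the `r` requested elements moves forward by `d`. Offline stays in `Ω`, whose
    -- first element is requested, and pays 1.
    serve : ∀ (π Ω : Perm n) {d A B} bs → AllPairs _<_ (0 ∷ bs) → (ws : All (λ b → b + d < n) (0 ∷ bs)) →
            length (0 ∷ bs) ≡ r → ∀ {e} → e ∈ request π d (0 ∷ bs) → at Ω e ≡ 0 →
            Play r (advancesₚ d (0 ∷ bs) ws π) Ω A B → Play r π Ω (r * d + A) (suc B)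
    serve π Ω {d} {A} {B} bs sorted ws length≡r {e} e∈S Ωe≡0 P = record
      { len      = suc (len P)
      ; requests = S ∷ requests P
      ; uniform  = card Vecᴬ.∷ uniform P
      ; opt      = Ω ∷ opt P
      ; run      = σ ∷ run P
      ; isRun    = step , isRun P
      ; online≥  = online
      ; offline≤ = +-mono-≤ service (offline≤ P) }
      where
      S = request π d (0 ∷ bs)
      σ = advancesₚ d (0 ∷ bs) ws π
      card : ∣ S ∣ ≡ r
      card = trans (card-request π (0 ∷ bs) sorted ws) length≡r
      step : MAEStep π S σ
      step = advancesₚ-MAEStep π bs sorted ws
      service : access Ω S + dKT Ω Ω ≤ 1
      service = +-mono-≤ {access Ω S} {1} (≤-trans (access-≤ Ω e∈S) (≤-reflexive (cong suc Ωe≡0))) (≤-reflexive (dKT-self Ω))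
      online : ∀ run′ → MAERun π (S ∷ requests P) run′ → r * d + A ≤ onlineCost π (S ∷ requests P) run′
      online (τ ∷ τs) (step′ , run′) = +-mono-≤ {r * d} move later
        where
        σ≈τ : ∀ e → at σ e ≡ at τ e
        σ≈τ = MAEStep-unique {π = π} {σ} {τ} step step′
        forward : ∀ e → e ∈ S → at τ e + d ≤ at π e
        forward e e∈ with find (∈-request⁻ π (0 ∷ bs) e∈)
        ... | b , b∈ , eq = ≤-reflexive (begin
          at τ e + d                         ≡⟨ cong (_+ d) (σ≈τ e) ⟨
          at σ e + d                         ≡⟨ cong (_+ d) (at-advancesₚ d (0 ∷ bs) ws π e) ⟩
          advances d (0 ∷ bs) (at π e) + d   ≡⟨ cong (λ q → advances d (0 ∷ bs) q + d) eq ⟩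
          advances d (0 ∷ bs) (b + d) + d    ≡⟨ cong (_+ d) (advances-top (0 ∷ bs) sorted b∈) ⟩
          b + d                              ≡⟨ eq ⟨
          at π e                             ∎)
          where open ≡-Reasoning
        move : r * d ≤ access π S + dKT π τ
        move = ≤-trans (≤-reflexive (cong (_* d) (sym card)))
                       (≤-trans (forward-≤-dKT π τ S d forward) (m≤n+m _ (access π S)))
        -- An arbitrary run continues from `τ`, which agrees with `σ` in all positions, so the bound
        -- known from `σ` applies.
        later : A ≤ onlineCost τ (requests P) τs
        later = ≤-trans (online≥ P τs (MAERun-congˡ {π = τ} {σ} (sym ∘ σ≈τ) (requests P) τs run′))
                        (≤-reflexive (onlineCost-congˡ {π = σ} {τ} σ≈τ (requests P) τs))

  -- The elements are brought to the very front one after another; each such move pushes the earlier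
  -- ones back by at most one position.
  front-loaded : ∀ {n} (es : List (Fin n)) → Σ (Perm n) λ Ω → All (λ e → at Ω e < length es) es
  front-loaded []       = idₚ , []
  front-loaded {n} (e ∷ es) with front-loaded es
  ... | Ω , below = Ω ∘ₚ advanceₚ 0 (at Ω e) (at<n Ω e) , first ∷ All.map shifted below
    where
    Ω′ = Ω ∘ₚ advanceₚ 0 (at Ω e) (at<n Ω e)
    moved : ∀ f → at Ω′ f ≡ advance 0 (at Ω e) (at Ω f)
    moved = at-advanceₚ Ω 0 (at Ω e) (at<n Ω e)
    first : at Ω′ e < suc (length es)
    first = subst (_< suc (length es)) (sym (trans (moved e) (advance-top 0 (at Ω e)))) (s≤s z≤n)
    shifted : ∀ {f} → at Ω f < length es → at Ω′ f < suc (length es)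
    shifted {f} lt = s≤s (≤-trans (≤-reflexive (moved f)) (≤-trans (advance-≤-suc 0 (at Ω e) (at Ω f)) lt))

  advances-++ : ∀ d xs ys q → advances d (xs ++ ys) q ≡ advances d ys (advances d xs q)
  advances-++ d []       ys q = refl
  advances-++ d (b ∷ xs) ys q = advances-++ d xs ys (advance b d q)

  -- The adversary: blocks, phases and rounds

  module Adversary (s h : ℕ) where

    -- Companions are drawn from the `2 + s` positions `h` to `f ∸ 1`. The two groups occupy the `h`
    -- positions from `f` and the `h` positions from `f + h * h`, the latter ending at `n ∸ 1`.
    r f n : ℕ
    r = 3 + s
    f = h + (2 + s)
    n = f + (h * h + h)

    -- The h positions x 0 , … , x (h − 1) are consecutive, starting at a, except that position p,
    -- if it lies among them, is skipped.
    Block : (a p : ℕ) → (ℕ → ℕ) → Set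
    Block a p x =
      (a ≤ p × ∀ {j} → j < h → (a + j < p → x j ≡ a + j) × (p ≤ a + j → x j ≡ suc (a + j))) ⊎
      (p < a × ∀ {j} → j < h → x j ≡ a + j)

    Block-≥ : ∀ {a p x j} → Block a p x → j < h → a ≤ x j
    Block-≥ {a} {p} {x} {j} (inj₁ (_ , B)) j<h with a + j <? p
    ... | yes lt = ≤-trans (m≤m+n a j) (≤-reflexive (sym (proj₁ (B j<h) lt)))
    ... | no ¬lt = ≤-trans (m≤n⇒m≤1+n (m≤m+n a j)) (≤-reflexive (sym (proj₂ (B j<h) (≮⇒≥ ¬lt))))
    Block-≥ {a} {j = j} (inj₂ (_ , B)) j<h = ≤-trans (m≤m+n a j) (≤-reflexive (sym (B j<h)))

    Block-cong : ∀ {a p x y} → (∀ {j} → j < h → x j ≡ y j) → Block a p x → Block a p y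
    Block-cong eq (inj₁ (a≤p , B)) = inj₁ (a≤p , λ j<h →
      (λ lt → trans (sym (eq j<h)) (proj₁ (B j<h) lt)) , (λ ge → trans (sym (eq j<h)) (proj₂ (B j<h) ge)))
    Block-cong eq (inj₂ (p<a , B)) = inj₂ (p<a , λ j<h → trans (sym (eq j<h)) (B j<h))

    -- A request has the targets `0` to `k` in the front region and those in `rest`: `c` for the
    -- leader and, where needed, `a` for the element that jumps over the block. The value of `k`
    -- fills the request up to size `r`.
    record Windows (a c : ℕ) (x : ℕ → ℕ) : Set where
      field
        k       : ℕ
        rest    : List ℕ
        k≤      : k ≤ suc s
        size    : suc k + length rest ≡ r
        sorted  : AllPairs _<_ rest
        either  : All (λ b → b ≡ a ⊎ b ≡ c) rest
        c∈      : c ∈ˡ rest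
        shifted : Block (suc a) c (advances h rest ∘ x)

    -- The leader jumps from c + h to c. The block moves back by one position in every case:
    -- either the element behind it jumps to its front, or the leader itself crosses it.
    windows : ∀ {a c x} → Block a (c + h) x → Windows a c x
    windows {a} {c} {x} (inj₁ (a≤p , B)) with a <? c
    -- The leader stands behind `a + h`, so the block has no gap yet; landing at `c`, the leader may
    -- open one there.
    ... | yes a<c = record
      { k = s ; rest = a ∷ c ∷ [] ; k≤ = n≤1+n s
      ; size = cong suc (+-comm s 2)
      ; sorted = (a<c ∷ []) ∷ [] ∷ []
      ; either = inj₁ refl ∷ inj₂ refl ∷ []
      ; c∈ = there (here refl)
      ; shifted = inj₁ (a<c , λ j<h → before j<h , inside j<h) }
      where
      pushed : ∀ {j} → j < h → advance a h (x j) ≡ suc (a + j)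
      pushed {j} j<h = trans (cong (advance a h) (proj₁ (B j<h) (+-mono-<-≤ a<c (<⇒≤ j<h))))
                             (advance-mid (m≤m+n a j) (+-monoʳ-< a j<h))
      before : ∀ {j} → j < h → suc (a + j) < c → advance c h (advance a h (x j)) ≡ suc (a + j)
      before j<h lt = trans (cong (advance c h) (pushed j<h)) (advance-low lt)
      inside : ∀ {j} → j < h → c ≤ suc (a + j) → advance c h (advance a h (x j)) ≡ suc (suc (a + j))
      inside j<h ge = trans (cong (advance c h) (pushed j<h)) (advance-mid ge (+-mono-≤-< a<c j<h))
    -- Now `c ≤ a ≤ c + h`, so the leader is inside the block or directly next to it. Its jump
    -- pushes back the part of the block ahead of it and closes the gap; one more front companion
    -- replaces the target `a`.
    ... | no a≮c = record
      { k = suc s ; rest = c ∷ [] ; k≤ = ≤-refl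
      ; size = cong (suc ∘ suc) (+-comm s 1)
      ; sorted = [] ∷ []
      ; either = inj₂ refl ∷ []
      ; c∈ = here refl
      ; shifted = inj₂ (s≤s c≤a , crossed) }
      where
      c≤a : c ≤ a
      c≤a = ≮⇒≥ a≮c
      crossed : ∀ {j} → j < h → advance c h (x j) ≡ suc (a + j)
      crossed {j} j<h with a + j <? c + h
      ... | yes lt = trans (cong (advance c h) (proj₁ (B j<h) lt)) (advance-mid (≤-trans c≤a (m≤m+n a j)) lt)
      ... | no ¬lt = trans (cong (advance c h) (proj₂ (B j<h) (≮⇒≥ ¬lt))) (advance-high {c} {h} (s≤s (≮⇒≥ ¬lt)))
    windows {a} {c} {x} (inj₂ (p<a , B)) = record
      { k = s ; rest = c ∷ a ∷ [] ; k≤ = n≤1+n s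
      ; size = cong suc (+-comm s 2)
      ; sorted = (c<a ∷ []) ∷ [] ∷ []
      ; either = inj₂ refl ∷ inj₁ refl ∷ []
      ; c∈ = here refl
      ; shifted = inj₂ (m<n⇒m<1+n c<a , behind) }
      where
      c<a : c < a
      c<a = ≤-<-trans (m≤m+n c h) p<a
      behind : ∀ {j} → j < h → advance a h (advance c h (x j)) ≡ suc (a + j)
      behind {j} j<h = trans
        (cong (advance a h) (trans (cong (advance c h) (B j<h)) (advance-high {c} {h} (<-≤-trans p<a (m≤m+n a j)))))
        (advance-mid (m≤m+n a j) (+-monoʳ-< a j<h))

    -- i elements of Y have already been brought to the front.
    record Configuration (i : ℕ) (π : Perm n) (X Y : ℕ → Fin n) : Set where
      field
        block    : ∀ {j} → j < h → at π (X j) ≡ f + (i * h + j)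
        served   : ∀ {j} → j < i → at π (Y j) ≡ f + j
        unserved : ∀ {j} → i ≤ j → j < h → at π (Y j) ≡ f + (h * h + j)

    -- t requests containing Y i have been made, and u more are to come.
    record InPhase (i t u : ℕ) (π : Perm n) (X Y : ℕ → Fin n) : Set where
      field
        leader   : at π (Y i) ≡ f + (u * h + i)
        block    : Block (f + (i * h + t)) (f + (u * h + i)) (λ j → at π (X j))
        served   : ∀ {j} → j < i → at π (Y j) ≡ f + j
        unserved : ∀ {j} → i < j → j < h → at π (Y j) ≡ f + (h * h + j)

    open Configuration
    open InPhase

    -- The leader at `f + (h * h + i)` is still behind the whole block because `i < h`, so no
    -- position of the block is skipped.
    enter : ∀ {i π X Y} → i < h → Configuration i π X Y → InPhase i 0 h π X Y
    enter {i} {π} {X} {Y} i<h C = record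
      { leader   = unserved C ≤-refl i<h
      ; block    = inj₁ (+-monoʳ-≤ f (+-mono-≤ (*-monoˡ-≤ h (<⇒≤ i<h)) z≤n) , λ {j} j<h →
          (λ _ → trans (block C j<h) (eq j)) ,
          (λ ge → contradiction (<-≤-trans (in-front j<h) ge) (<-irrefl (eq j))))
      ; served   = served C
      ; unserved = λ i<j → unserved C (<⇒≤ i<j) }
      where
      eq : ∀ j → f + (i * h + j) ≡ f + (i * h + 0) + j
      eq j = trans (cong (λ z → f + (z + j)) (sym (+-identityʳ (i * h)))) (sym (+-assoc f (i * h + 0) j))
      in-front : ∀ {j} → j < h → f + (i * h + j) < f + (h * h + i)
      in-front {j} j<h = +-monoʳ-< f (begin-strict
        i * h + j  <⟨ +-monoʳ-< (i * h) j<h ⟩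
        i * h + h  ≡⟨ +-comm (i * h) h ⟩
        suc i * h  ≤⟨ *-monoˡ-≤ h i<h ⟩
        h * h      ≤⟨ m≤m+n (h * h) i ⟩
        h * h + i  ∎)
        where open ≤-Reasoning

    -- The leader has reached `f + i`, which precedes the block start `f + (i * h + h)` because
    -- `i < h`; the block is therefore contiguous again.
    leave : ∀ {i π X Y} → i < h → InPhase i h 0 π X Y → Configuration (suc i) π X Y
    leave {i} {π} {X} {Y} i<h P = record
      { block    = λ {j} j<h → trans (after (block P) j<h) (eq j)
      ; served   = served′
      ; unserved = unserved P }
      where
      eq : ∀ j → f + (i * h + h) + j ≡ f + (suc i * h + j)
      eq j = trans (+-assoc f (i * h + h) j) (cong (λ z → f + (z + j)) (+-comm (i * h) h))
      after : ∀ {x j} → Block (f + (i * h + h)) (f + i) x → j < h → x j ≡ f + (i * h + h) + j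
      after (inj₁ (a≤p , _)) _   = contradiction (≤-trans (m≤n+m h (i * h)) (+-cancelˡ-≤ f _ _ a≤p)) (<⇒≱ i<h)
      after (inj₂ (_ , B))   j<h = B j<h
      served′ : ∀ {j} → j < suc i → at π (Y j) ≡ f + j
      served′ {j} (s≤s j≤i) with m≤n⇒m<n∨m≡n j≤i
      ... | inj₁ j<i  = served P j<i
      ... | inj₂ refl = leader P

    -- At `i = h` the group `X` stands at `f + h * h` and `Y` at `f`, the mirror image of the
    -- configuration with nothing served.
    swap-roles : ∀ {π X Y} → Configuration h π X Y → Configuration 0 π Y X
    swap-roles C = record
      { block    = λ j<h → served C j<h
      ; served   = λ ()
      ; unserved = λ _ j<h → block C j<h }

    module Advance {i t u} (i<h : i < h) (t+u : t + suc u ≡ h) (π : Perm n) (X Y : ℕ → Fin n)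
                   (P : InPhase i t (suc u) π X Y) where

      a c : ℕ
      a = f + (i * h + t)
      c = f + (u * h + i)

      start : suc u * h + i ≡ u * h + i + h
      start = trans (+-assoc h (u * h) i) (+-comm h (u * h + i))

      c+h : f + (suc u * h + i) ≡ c + h
      c+h = trans (cong (f +_) start) (sym (+-assoc f (u * h + i) h))

      open Windows (windows {a} {c} (subst (λ p → Block a p (λ j → at π (X j))) c+h (block P)))

      su≤h : suc u ≤ h
      su≤h = ≤-trans (m≤n+m (suc u) t) (≤-reflexive t+u)

      t<h : t < h
      t<h = <-≤-trans (m<m+n t {suc u} (s≤s z≤n)) (≤-reflexive t+u)

      front bs : List ℕ
      front = applyUpTo id (suc k)
      bs = applyUpTo suc k ++ rest

      f≤rest : All (f ≤_) rest
      f≤rest = All.map (λ { (inj₁ refl) → m≤m+n f _ ; (inj₂ refl) → m≤m+n f _ }) either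

      front<f : ∀ {b} → b < suc k → b + h < f
      front<f {b} (s≤s b≤k) = ≤-trans (s≤s (+-monoˡ-≤ h (≤-trans b≤k k≤))) (≤-reflexive (+-comm (2 + s) h))

      all-sorted : AllPairs _<_ (0 ∷ bs)
      all-sorted = AllPairsₚ.++⁺ (AllPairsₚ.applyUpTo⁺₁ id (suc k) (λ i<j _ → i<j)) sorted
        (Allₚ.applyUpTo⁺₁ id (suc k) λ b<k →
          All.map (λ f≤b → <-≤-trans (≤-<-trans (m≤m+n _ h) (front<f b<k)) f≤b) f≤rest)

      a+h<n : a + h < n
      a+h<n = ≤-<-trans (≤-reflexive (+-assoc f (i * h + t) h)) (+-monoʳ-< f (+-monoˡ-< h (begin-strict
        i * h + t  <⟨ +-monoʳ-< (i * h) t<h ⟩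
        i * h + h  ≡⟨ +-comm (i * h) h ⟩
        suc i * h  ≤⟨ *-monoˡ-≤ h i<h ⟩
        h * h      ∎)))
        where open ≤-Reasoning

      c+h<n : c + h < n
      c+h<n = ≤-<-trans (≤-reflexive (sym c+h)) (+-monoʳ-< f (+-mono-≤-< (*-monoˡ-≤ h su≤h) i<h))

      in-range : All (λ b → b + h < n) (0 ∷ bs)
      in-range = Allₚ.++⁺ (Allₚ.applyUpTo⁺₁ id (suc k) λ b<k → <-≤-trans (front<f b<k) (m≤m+n f _))
        (All.map (λ { (inj₁ refl) → a+h<n ; (inj₂ refl) → c+h<n }) either)

      full : length (0 ∷ bs) ≡ r
      full = trans (cong suc (trans (length-++ (applyUpTo suc k)) (cong (_+ length rest) (length-applyUpTo suc k)))) size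

      σ : Perm n
      σ = advancesₚ h (0 ∷ bs) in-range π

      -- The windows of the front companions end before `f`, so only the windows in `rest` affect
      -- elements from `f` on.
      at-σ : ∀ {e q} → at π e ≡ q → f ≤ q → at σ e ≡ advances h rest q
      at-σ {e} {q} refl f≤q = begin
        at σ e                              ≡⟨ at-advancesₚ h (0 ∷ bs) in-range π e ⟩
        advances h (front ++ rest) q        ≡⟨ advances-++ h front rest q ⟩
        advances h rest (advances h front q)
          ≡⟨ cong (advances h rest) (advances-high front (Allₚ.applyUpTo⁺₁ id (suc k) λ b<k → <-≤-trans (front<f b<k) f≤q)) ⟩
        advances h rest q                   ∎
        where open ≡-Reasoning

      ahead : ∀ {e q} → at π e ≡ f + q → f + q < a → f + q < c → at σ e ≡ f + q
      ahead eq <a <c = trans (at-σ eq (m≤m+n f _))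
        (advances-low rest (All.map (λ { (inj₁ refl) → <a ; (inj₂ refl) → <c }) either))

      behind : ∀ {e q} → at π e ≡ f + q → a + h < f + q → c + h < f + q → at σ e ≡ f + q
      behind eq >a >c = trans (at-σ eq (m≤m+n f _))
        (advances-high rest (All.map (λ { (inj₁ refl) → >a ; (inj₂ refl) → >c }) either))

      leader-at : at π (Y i) ≡ c + h
      leader-at = trans (leader P) c+h

      leader-requested : Y i ∈ request π h (0 ∷ bs)
      leader-requested = ∈-request⁺ π (0 ∷ bs) (∈-++⁺ʳ front c∈) leader-at

      -- Served elements stand ahead of both possible windows and unserved ones behind both; within
      -- the two groups only the leader and the block move.
      next : InPhase i (suc t) u σ X Y
      next = record
        { leader   = trans (at-σ leader-at (≤-trans (m≤m+n f _) (m≤m+n c h))) (advances-top rest sorted c∈)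
        ; block    = subst (λ a′ → Block a′ c (λ j → at σ (X j))) suc-a
            (Block-cong (λ j<h → sym (at-σ refl (≤-trans (m≤m+n f _) (Block-≥ (block P) j<h)))) shifted)
        ; served   = λ {j} j<i → ahead (served P j<i)
            (+-monoʳ-< f (<-≤-trans j<i (≤-trans (m≤m*n i h) (m≤m+n (i * h) t))))
            (+-monoʳ-< f (<-≤-trans j<i (m≤n+m i (u * h))))
        ; unserved = λ {j} i<j j<h → behind (unserved P i<j j<h)
            (≤-<-trans (≤-reflexive (+-assoc f (i * h + t) h)) (+-monoʳ-< f (beyond i<j j<h)))
            (≤-<-trans (≤-reflexive (sym c+h)) (+-monoʳ-< f (+-mono-≤-< (*-monoˡ-≤ h su≤h) i<j))) }
        where
        instance
          h≢0 : NonZero h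
          h≢0 = >-nonZero (≤-<-trans z≤n i<h)
        suc-a : suc a ≡ f + (i * h + suc t)
        suc-a = trans (sym (+-suc f (i * h + t))) (cong (f +_) (sym (+-suc (i * h) t)))
        -- From `i < j < h` follows `i + 2 ≤ h`, which leaves room for the window beyond the block.
        beyond : ∀ {j} → i < j → j < h → i * h + t + h < h * h + j
        beyond {j} i<j j<h = begin-strict
          i * h + t + h      <⟨ +-monoˡ-< h (+-monoʳ-< (i * h) t<h) ⟩
          i * h + h + h      ≡⟨ trans (+-comm (i * h + h) h) (cong (h +_) (+-comm (i * h) h)) ⟩
          suc (suc i) * h    ≤⟨ *-monoˡ-≤ h (≤-<-trans i<j j<h) ⟩
          h * h              ≤⟨ m≤m+n (h * h) j ⟩
          h * h + j          ∎
          where open ≤-Reasoning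

    -- Each of the `u` remaining requests costs `r * h` online and 1 offline. The permutation at the
    -- end is known only through its configuration, hence the continuation `K`.
    play-phase : ∀ {i} (i<h : i < h) u t → t + u ≡ h → ∀ π Ω X Y {A B} → InPhase i t u π X Y → at Ω (Y i) ≡ 0 →
                 (∀ σ → Configuration (suc i) σ X Y → Play r σ Ω A B) → Play r π Ω (u * (r * h) + A) (u + B)
    play-phase {i} i<h zero t t+u π Ω X Y P Ω≡0 K =
      K π (leave i<h (subst (λ t → InPhase i t 0 π X Y) (trans (sym (+-identityʳ t)) t+u) P))
    play-phase {i} i<h (suc u) t t+u π Ω X Y {A} {B} P Ω≡0 K =
      relax (≤-reflexive (+-assoc (r * h) (u * (r * h)) A)) ≤-refl
        (serve π Ω bs all-sorted in-range full leader-requested Ω≡0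
          (play-phase i<h u (suc t) (trans (sym (+-suc t u)) t+u) σ Ω X Y next Ω≡0 K))
      where open Advance {i} {t} {u} i<h t+u π X Y P

    -- A phase costs offline at most `h + h` to bring the leader to the front and `h` for its
    -- requests. That both groups stay within the first `h + h` positions is the invariant `near`.
    play : ∀ M {i} → i < h → ∀ π Ω X Y → Configuration i π X Y →
           (∀ {j} → j < h → at Ω (X j) < h + h × at Ω (Y j) < h + h) →
           Play r π Ω (M * (h * (r * h))) (M * (h + h + h))
    play zero    i<h π Ω X Y C near = stop
    play (suc M) {i} i<h π Ω X Y C near =
      relax ≤-refl cost (reorganise Ω Ω′ (play-phase i<h h 0 refl π Ω′ X Y (enter i<h C) leader-first continue))
      where
      d = at Ω (Y i)
      Ω′ = Ω ∘ₚ advanceₚ 0 d (at<n Ω (Y i))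
      moved : ∀ e → at Ω′ e ≡ advance 0 d (at Ω e)
      moved = at-advanceₚ Ω 0 d (at<n Ω (Y i))
      d<2h : d < h + h
      d<2h = proj₂ (near i<h)
      leader-first : at Ω′ (Y i) ≡ 0
      leader-first = trans (moved (Y i)) (advance-top 0 d)
      near-Ω′ : ∀ e → at Ω e < h + h → at Ω′ e < h + h
      near-Ω′ e lt = subst (_< h + h) (sym (moved e)) (advance-< (at Ω e) d<2h lt)
      near′ : ∀ {j} → j < h → at Ω′ (X j) < h + h × at Ω′ (Y j) < h + h
      near′ j<h = near-Ω′ _ (proj₁ (near j<h)) , near-Ω′ _ (proj₂ (near j<h))
      cost : dKT Ω Ω′ + (h + M * (h + h + h)) ≤ h + h + h + M * (h + h + h)
      cost = begin
        dKT Ω Ω′ + (h + M * (h + h + h))  ≤⟨ +-monoˡ-≤ _ (≤-trans (dKT-advance-front Ω d (at<n Ω (Y i))) (<⇒≤ d<2h)) ⟩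
        h + h + (h + M * (h + h + h))     ≡⟨ +-assoc (h + h) h _ ⟨
        h + h + h + M * (h + h + h)       ∎
        where open ≤-Reasoning
      continue : ∀ σ → Configuration (suc i) σ X Y → Play r σ Ω′ (M * (h * (r * h))) (M * (h + h + h))
      continue σ C′ with m≤n⇒m<n∨m≡n i<h
      ... | inj₁ i+1<h = play M i+1<h σ Ω′ X Y C′ near′
      -- All of `Y` has been served, so the next phase starts a round with the groups exchanged.
      ... | inj₂ refl  = play M (≤-<-trans z≤n i<h) σ Ω′ Y X (swap-roles C′)
                           (λ j<h → proj₂ (near′ j<h) , proj₁ (near′ j<h))

  -- The starting permutation and the counting of costs

  module Initial (s h : ℕ) (0<h : 0 < h) where
    open Adversary s h

    instance
      n≢0 : NonZero n
      n≢0 = >-nonZero (≤-trans 0<h (≤-trans (m≤m+n h (2 + s)) (m≤m+n f _)))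

    X Y : ℕ → Fin n
    X j = (f + j) mod n
    Y j = (f + (h * h + j)) mod n

    at-mod : ∀ {q} → q < n → toℕ (q mod n) ≡ q
    at-mod {q} q<n = trans (toℕ-fromℕ< (m%n<n q n)) (m<n⇒m%n≡m q<n)

    initial : Configuration 0 idₚ X Y
    initial = record
      { block    = λ {j} j<h → at-mod (+-monoʳ-< f (<-≤-trans j<h (m≤n+m h (h * h))))
      ; served   = λ ()
      ; unserved = λ _ j<h → at-mod (+-monoʳ-< f (+-monoʳ-< (h * h) j<h)) }

    active : List (Fin n)
    active = map X (upTo h) ++ map Y (upTo h)

    length-active : length active ≡ h + h
    length-active = trans (length-++ (map X (upTo h)))
      (cong₂ _+_ (trans (length-map X (upTo h)) (length-upTo h)) (trans (length-map Y (upTo h)) (length-upTo h)))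

    Ω₀ : Perm n
    Ω₀ = proj₁ (front-loaded active)

    near : ∀ {j} → j < h → at Ω₀ (X j) < h + h × at Ω₀ (Y j) < h + h
    near j<h = below (∈-++⁺ˡ (∈-map⁺ X (∈-upTo⁺ j<h))) , below (∈-++⁺ʳ (map X (upTo h)) (∈-map⁺ Y (∈-upTo⁺ j<h)))
      where
      below : ∀ {e} → e ∈ˡ active → at Ω₀ e < h + h
      below e∈ = <-≤-trans (All.lookup (proj₂ (front-loaded active)) e∈) (≤-reflexive length-active)

    -- Both sides start from the identity; gathering the groups at the front costs offline
    -- `dKT idₚ Ω₀` once, independently of `M`.
    rounds : ∀ M → Play r idₚ idₚ (M * (h * (r * h))) (dKT idₚ Ω₀ + M * (h + h + h))
    rounds M = reorganise idₚ Ω₀ (play M 0<h idₚ Ω₀ X Y initial near)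

    -- This makes `h` at least half the square root of `n`.
    n-≤ : 2 + s ≤ h → n ≤ 4 * (h * h)
    n-≤ 2+s≤h = begin
      h + (2 + s) + (h * h + h)   ≤⟨ +-monoˡ-≤ _ (+-monoʳ-≤ h 2+s≤h) ⟩
      h + h + (h * h + h)           ≤⟨ +-mono-≤ (+-mono-≤ h≤ h≤) (+-monoʳ-≤ (h * h) h≤) ⟩
      h * h + h * h + (h * h + h * h) ≡⟨ four (h * h) ⟩
      4 * (h * h)                       ∎
      where
      open ≤-Reasoning
      h≤ : h ≤ h * h
      h≤ = m≤m*n h h {{>-nonZero 0<h}}
      four : ∀ x → x + x + (x + x) ≡ 4 * x
      four = solve-∀

  -- With `m` for `r * h`, a phase has ratio `h * m` to `3 * h`, that is `m / 3`. The number `M` of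
  -- phases exceeds `m * D + 6 * α`, so half of this ratio absorbs the setup cost and the additive
  -- constant, and `m / 6` remains.
  cost-gap : ∀ m h D α {off on} → 1 ≤ m → 1 ≤ h →
    let M = suc (m * D + 6 * α) in
    off ≤ D + M * (h + h + h) → M * (h * m) ≤ on →
    m * off + 6 * α < 6 * on
  cost-gap m h D α {off} {on} 1≤m 1≤h off≤ on≥ = begin-strict
    m * off + 6 * α                                    ≤⟨ +-monoˡ-≤ (6 * α) (*-monoʳ-≤ m off≤) ⟩
    m * (D + M * (h + h + h)) + 6 * α          ≡⟨ regroup m D M h α ⟩
    (m * D + 6 * α) + 3 * (M * (h * m))        <⟨ +-monoˡ-< (3 * (M * (h * m))) (n<1+n (m * D + 6 * α)) ⟩
    M + 3 * (M * (h * m))                            ≤⟨ +-monoˡ-≤ _ M≤ ⟩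
    3 * (M * (h * m)) + 3 * (M * (h * m))      ≡⟨ double (M * (h * m)) ⟩
    6 * (M * (h * m))                                  ≤⟨ *-monoʳ-≤ 6 on≥ ⟩
    6 * on                                                 ∎
    where
    open ≤-Reasoning
    M = suc (m * D + 6 * α)
    regroup : ∀ m D M h α → m * (D + M * (h + h + h)) + 6 * α
                          ≡ (m * D + 6 * α) + 3 * (M * (h * m))
    regroup = solve-∀
    double : ∀ x → 3 * x + 3 * x ≡ 6 * x
    double = solve-∀
    M≤ : M ≤ 3 * (M * (h * m))
    M≤ = ≤-trans (m≤m*n M (h * m) {{>-nonZero (*-mono-≤ 1≤h 1≤m)}}) (m≤n*m _ 3)

open import Data.Nat using (ℕ; suc; s≤s; z≤n; _≤_; _≥_)
open import Data.Integer using (+_)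
open import Data.Rational using (ℚ; _/_; _*_; _+_; _<_; 0ℚ)
import Data.Rational as Q
open import Data.Fin.Subset using (Subset; ∣_∣)
open import Data.Vec using (Vec)
open import Data.Vec.Relation.Unary.All using (All)
open import Data.Product using (Σ; _×_; _,_)
open import Relation.Binary.PropositionalEquality using (_≡_; refl; sym; trans; cong; cong₂; subst₂)
open import Data.Fin.Permutation using () renaming (id to idₚ)
import Data.Integer as ℤ
import Data.Integer.Properties as ℤₚ
import Data.Nat as ℕ
import Data.Nat.Properties as ℕₚ
import Data.Rational.Properties as Qₚ
open import Data.Rational.Solver using (module +-*-Solver)
import Data.Rational.Unnormalised as Qᵘ
import Data.Rational.Unnormalised.Properties as Qᵘₚ
open import Data.Sum using (inj₁; inj₂)
open import Relation.Nullary using (yes; no; contradiction)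

open Game

-- Transfer to the rationals

ι : ℕ → ℚ
ι m = + m / 1

ι-toℚᵘ : ∀ m → Q.toℚᵘ (ι m) Qᵘ.≃ Qᵘ.mkℚᵘ (+ m) 0
ι-toℚᵘ m = Qₚ.toℚᵘ-fromℚᵘ (Qᵘ.mkℚᵘ (+ m) 0)

ι-+ : ∀ a b → ι (a ℕ.+ b) ≡ ι a + ι b
ι-+ a b = Qₚ.toℚᵘ-injective (begin-equality
  Q.toℚᵘ (ι (a ℕ.+ b))                          ≃⟨ ι-toℚᵘ (a ℕ.+ b) ⟩
  Qᵘ.mkℚᵘ (+ (a ℕ.+ b)) 0
    ≡⟨ cong (λ z → Qᵘ.mkℚᵘ z 0) (cong₂ ℤ._+_ (ℤₚ.*-identityʳ (+ a)) (ℤₚ.*-identityʳ (+ b))) ⟨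
  Qᵘ.mkℚᵘ (+ a) 0 Qᵘ.+ Qᵘ.mkℚᵘ (+ b) 0        ≃⟨ Qᵘₚ.+-cong (ι-toℚᵘ a) (ι-toℚᵘ b) ⟨
  Q.toℚᵘ (ι a) Qᵘ.+ Q.toℚᵘ (ι b)                  ≃⟨ Qₚ.toℚᵘ-homo-+ (ι a) (ι b) ⟨
  Q.toℚᵘ (ι a + ι b)                            ∎)
  where open Qᵘₚ.≤-Reasoning

ι-* : ∀ a b → ι (a ℕ.* b) ≡ ι a * ι b
ι-* a b = Qₚ.toℚᵘ-injective (begin-equality
  Q.toℚᵘ (ι (a ℕ.* b))                          ≃⟨ ι-toℚᵘ (a ℕ.* b) ⟩
  Qᵘ.mkℚᵘ (+ (a ℕ.* b)) 0                     ≡⟨ cong (λ z → Qᵘ.mkℚᵘ z 0) (ℤₚ.pos-* a b) ⟩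
  Qᵘ.mkℚᵘ (+ a) 0 Qᵘ.* Qᵘ.mkℚᵘ (+ b) 0        ≃⟨ Qᵘₚ.*-cong (ι-toℚᵘ a) (ι-toℚᵘ b) ⟨
  Q.toℚᵘ (ι a) Qᵘ.* Q.toℚᵘ (ι b)                  ≃⟨ Qₚ.toℚᵘ-homo-* (ι a) (ι b) ⟨
  Q.toℚᵘ (ι a * ι b)                            ∎)
  where open Qᵘₚ.≤-Reasoning

ι-mono-< : ∀ {a b} → a ℕ.< b → ι a < ι b
ι-mono-< {a} {b} a<b = Qₚ.toℚᵘ-cancel-< (Qᵘₚ.<-respˡ-≃ (Qᵘₚ.≃-sym (ι-toℚᵘ a)) (Qᵘₚ.<-respʳ-≃ (Qᵘₚ.≃-sym (ι-toℚᵘ b))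
  (Qᵘ.*<* (subst₂ ℤ._<_ (sym (ℤₚ.*-identityʳ (+ a))) (sym (ℤₚ.*-identityʳ (+ b))) (ℤ.+<+ a<b)))))

ι-mono-≤ : ∀ {a b} → a ≤ b → ι a Q.≤ ι b
ι-mono-≤ {a} {b} a≤b with ℕₚ.m≤n⇒m<n∨m≡n a≤b
... | inj₁ a<b  = Qₚ.<⇒≤ (ι-mono-< a<b)
... | inj₂ refl = Qₚ.≤-refl

ι-nonNeg : ∀ m → Q.NonNegative (ι m)
ι-nonNeg m = Qₚ.normalize-nonNeg m 1

-- The factor 1/6 left by `cost-gap` times the 1/2 lost in bounding `h` below by the square root of
-- `n`.
c₀ : ℚ
c₀ = + 1 / 12

sixth : ℕ → ℚ
sixth m = + 1 / 6 * ι m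

-- Square roots are avoided by comparing squares of nonnegative numbers: `q ≤ c′` would give
-- `q * q ≤ c′ * c′`, while `n ≤ 4 * (h * h)` bounds the right side of the hypothesis by `q * q`.
ratio-bound : ∀ {c′} r h n → 0ℚ Q.≤ c′ → n ≤ 4 ℕ.* (h ℕ.* h) →
              c′ * c′ < c₀ * c₀ * ι r * ι r * ι n → c′ < sixth (r ℕ.* h)
ratio-bound {c′} r h n 0≤c′ n≤4h² small with c′ Q.<? sixth (r ℕ.* h)
... | yes lt = lt
... | no ¬lt = contradiction (begin-strict
  c′ * c′                                     <⟨ small ⟩
  c₀ * c₀ * ι r * ι r * ι n                   ≤⟨ Qₚ.*-monoˡ-≤-nonNeg (c₀ * c₀ * ι r * ι r) (ι-mono-≤ n≤4h²) ⟩
  c₀ * c₀ * ι r * ι r * ι (4 ℕ.* (h ℕ.* h))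
    ≡⟨ cong (c₀ * c₀ * ι r * ι r *_) (trans (ι-* 4 (h ℕ.* h)) (cong (ι 4 *_) (ι-* h h))) ⟩
  c₀ * c₀ * ι r * ι r * (ι 4 * (ι h * ι h))   ≡⟨ square (ι r) (ι h) ⟩
  + 1 / 6 * (ι r * ι h) * (+ 1 / 6 * (ι r * ι h)) ≡⟨ cong (λ z → + 1 / 6 * z * (+ 1 / 6 * z)) (ι-* r h) ⟨
  q * q                                       ≤⟨ Qₚ.*-monoʳ-≤-nonNeg q q≤c′ ⟩
  c′ * q                                      ≤⟨ Qₚ.*-monoˡ-≤-nonNeg c′ q≤c′ ⟩
  c′ * c′                                     ∎) (Qₚ.<-irrefl refl)
  where
  open Qₚ.≤-Reasoning
  q = sixth (r ℕ.* h)
  q≤c′ : q Q.≤ c′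
  q≤c′ = Qₚ.≮⇒≥ ¬lt
  instance
    c′≥0 : Q.NonNegative c′
    c′≥0 = Q.nonNegative 0≤c′
    q≥0 : Q.NonNegative q
    q≥0 = Qₚ.nonNeg*nonNeg⇒nonNeg (+ 1 / 6) (ι (r ℕ.* h)) {{ι-nonNeg (r ℕ.* h)}}
    c₀²r²≥0 : Q.NonNegative (c₀ * c₀ * ι r * ι r)
    c₀²r²≥0 = Qₚ.nonNeg*nonNeg⇒nonNeg (c₀ * c₀ * ι r)
      {{Qₚ.nonNeg*nonNeg⇒nonNeg (c₀ * c₀) (ι r) {{ι-nonNeg r}}}} (ι r) {{ι-nonNeg r}}
  square : ∀ x y → c₀ * c₀ * x * x * (ι 4 * (y * y)) ≡ + 1 / 6 * (x * y) * (+ 1 / 6 * (x * y))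
  square = solve 2 (λ x y → con c₀ :* con c₀ :* x :* x :* (con (ι 4) :* (y :* y))
                         := con (+ 1 / 6) :* (x :* y) :* (con (+ 1 / 6) :* (x :* y))) refl
    where open +-*-Solver

competitive-gap : ∀ {c′} m off on α → c′ < sixth m → m ℕ.* off ℕ.+ 6 ℕ.* α ℕ.< 6 ℕ.* on →
                  c′ * ι off + ι α < ι on
competitive-gap {c′} m off on α c′<q gap = begin-strict
  c′ * ι off + ι α
    ≤⟨ Qₚ.+-monoˡ-≤ (ι α) (Qₚ.*-monoʳ-≤-nonNeg (ι off) {{ι-nonNeg off}} (Qₚ.<⇒≤ c′<q)) ⟩
  + 1 / 6 * ι m * ι off + ι α            ≡⟨ collect (ι m) (ι off) (ι α) ⟩
  + 1 / 6 * (ι m * ι off + ι 6 * ι α)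
    ≡⟨ cong (+ 1 / 6 *_) (trans (ι-+ (m ℕ.* off) (6 ℕ.* α)) (cong₂ _+_ (ι-* m off) (ι-* 6 α))) ⟨
  + 1 / 6 * ι (m ℕ.* off ℕ.+ 6 ℕ.* α)    <⟨ Qₚ.*-monoʳ-<-pos (+ 1 / 6) (ι-mono-< gap) ⟩
  + 1 / 6 * ι (6 ℕ.* on)                 ≡⟨ cong (+ 1 / 6 *_) (ι-* 6 on) ⟩
  + 1 / 6 * (ι 6 * ι on)                 ≡⟨ cancel (ι on) ⟩
  ι on                                   ∎
  where
  open Qₚ.≤-Reasoning
  open +-*-Solver
  collect : ∀ x y z → + 1 / 6 * x * y + z ≡ + 1 / 6 * (x * y + ι 6 * z)
  collect = solve 3 (λ x y z → con (+ 1 / 6) :* x :* y :+ z := con (+ 1 / 6) :* (x :* y :+ con (ι 6) :* z)) refl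
  cancel : ∀ x → + 1 / 6 * (ι 6 * x) ≡ x
  cancel = solve 1 (λ x → con (+ 1 / 6) :* (con (ι 6) :* x) := x) refl

-- The squared inequality expresses that `c′` is below `c` times `r` times the square root of `n`.
-- The cost of `opt` bounds the dynamic optimum from above, so exceeding it refutes
-- `c′`-competitiveness; a run is exhibited so that the claim about all runs is not vacuous.
theorem5 : Σ ℚ λ c → 0ℚ < c ×
    ((r : ℕ) → 3 ≤ r → (N : ℕ) → Σ ℕ λ n → n ≥ N ×
    ((c′ : ℚ) → 0ℚ Q.≤ c′ →
    c′ * c′ < c * c * (+ r / 1) * (+ r / 1) * (+ n / 1) →
    (α : ℕ) →
    Σ (Perm n) λ π₀ → Σ ℕ λ m → Σ (Vec (Subset n) m) λ Ss →
    All (λ S → ∣ S ∣ ≡ r) Ss ×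
    Σ (Vec (Perm n) m) λ opt →
    Σ (Vec (Perm n) m) (λ run → MAERun π₀ Ss run) ×
    ((run : Vec (Perm n) m) → MAERun π₀ Ss run →
    c′ * (+ offlineCost π₀ Ss opt / 1) + (+ α / 1)
    < (+ onlineCost π₀ Ss run / 1))))
theorem5 = c₀ , Qₚ.positive⁻¹ c₀ , lower-bound
  where
  lower-bound : _
  lower-bound (suc (suc (suc s))) (s≤s (s≤s (s≤s z≤n))) N = n , N≤n , beats
    where
    -- The summand `N` makes `n` large, and `3 + s` gives the bound `2 + s ≤ h` that `n-≤` requires.
    h = N ℕ.+ (3 ℕ.+ s)
    0<h : 0 ℕ.< h
    0<h = ℕₚ.≤-trans (s≤s z≤n) (ℕₚ.m≤n+m (3 ℕ.+ s) N)
    open Adversary s h using (r; f; n)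
    open Initial s h 0<h using (Ω₀; rounds; n-≤)
    N≤n : N ≤ n
    N≤n = ℕₚ.≤-trans (ℕₚ.m≤m+n N (3 ℕ.+ s)) (ℕₚ.≤-trans (ℕₚ.m≤m+n h (2 ℕ.+ s)) (ℕₚ.m≤m+n f _))
    beats : _
    beats c′ 0≤c′ small α =
      idₚ , Play.len P , Play.requests P , Play.uniform P , Play.opt P , (Play.run P , Play.isRun P) ,
      λ run isRun → competitive-gap (r ℕ.* h)
        (offlineCost idₚ (Play.requests P) (Play.opt P)) (onlineCost idₚ (Play.requests P) run) α
        (ratio-bound r h n 0≤c′ (n-≤ (ℕₚ.≤-trans (ℕₚ.n≤1+n _) (ℕₚ.m≤n+m (3 ℕ.+ s) N))) small)
        (cost-gap (r ℕ.* h) h D α (ℕₚ.*-mono-≤ {1} {r} (s≤s z≤n) 0<h) 0<h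
          (Play.offline≤ P) (Play.online≥ P run isRun))
      where
      D = dKT idₚ Ω₀
      P = rounds (suc (r ℕ.* h ℕ.* D ℕ.+ 6 ℕ.* α))
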